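{- Let $\alpha_{2,3} := \sum_{m=1}^{\infty} \frac{1}{3^m 2^{3^m}}$ (the Stoneham number). Then the sequence $(\{2^n \alpha_{2,3}\})_{n \in \mathbb{N}}$ does not have Poissonian pair correlations.
   Context: $\{x\}$ denotes the fractional part of $x$ and $\|x\|$ the distance from $x$ to the nearest integer. A sequence $(x_n)_{n\in\mathbb{N}}$ in $[0,1)$ has Poissonian pair correlations if for every $s \geq 0$, $F_N(s) := \frac{1}{N}\#\{1 \leq l \neq m \leq N : \|x_l - x_m\| \leq s/N\} \to 2s$ as $N\to\infty$. -}

module Defs where

open import Data.Integer.Base as ℤ using (ℤ; +_)
import Data.Integer.DivMod as ℤ
import Data.Integer.Properties as ℤ
open import Data.List.Base using (List; length)
open import Data.List.Membership.Propositional using (_∈_)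
open import Data.List.Relation.Unary.Unique.Propositional using (Unique)
open import Data.Nat.Base as ℕ using (ℕ; zero; suc; z≤n; s≤s)
import Data.Nat.Properties as ℕ
import Data.Nat.Solver as ℕ
open import Data.Product using (Σ; ∃; _×_; _,_; proj₁; proj₂)
open import Data.Rational.Base
open import Data.Rational.Properties
open import Data.Rational.Solver using (module +-*-Solver)
import Data.Rational.Unnormalised.Base as ℚᵘ
import Data.Rational.Unnormalised.Properties as ℚᵘ
open import Data.Sum.Base using ([_,_]′)
open import Function.Base using (case_of_; _∘_)
open import Function.Bundles using (_⇔_)
open import Relation.Binary.PropositionalEquality
  using (_≡_; _≢_; refl; sym; trans; cong; cong₂; subst; subst₂; module ≡-Reasoning)
open import Relation.Nullary.Decidable.Core using (yes; no)

open ℕ.+-*-Solver using ()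
  renaming (solve to ℕ-solve; _:*_ to _⊗_; _:=_ to _⊜_; con to ℕcon)
open +-*-Solver using (solve; _:+_; _:*_; _:-_; :-_; _:=_; con)

fromℤ : ℤ → ℚ
fromℤ i = i / 1

fromℤ-toℚᵘ : ∀ i → toℚᵘ (fromℤ i) ℚᵘ.≃ ℚᵘ.mkℚᵘ i 0
fromℤ-toℚᵘ i = toℚᵘ-fromℚᵘ (ℚᵘ.mkℚᵘ i 0)

fromℤ-mono-≤ : ∀ {i j} → i ℤ.≤ j → fromℤ i ≤ fromℤ j
fromℤ-mono-≤ {i} {j} i≤j = toℚᵘ-cancel-≤
  (ℚᵘ.≤-respˡ-≃ (ℚᵘ.≃-sym (fromℤ-toℚᵘ i)) (ℚᵘ.≤-respʳ-≃ (ℚᵘ.≃-sym (fromℤ-toℚᵘ j))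
    (ℚᵘ.*≤* (subst₂ ℤ._≤_ (sym (ℤ.*-identityʳ i)) (sym (ℤ.*-identityʳ j)) i≤j))))

fromℤ-cancel-< : ∀ {i j} → fromℤ i < fromℤ j → i ℤ.< j
fromℤ-cancel-< {i} {j} i<j = subst₂ ℤ._<_ (ℤ.*-identityʳ i) (ℤ.*-identityʳ j)
  (ℚᵘ.drop-*<* (ℚᵘ.<-respˡ-≃ (fromℤ-toℚᵘ i) (ℚᵘ.<-respʳ-≃ (fromℤ-toℚᵘ j) (toℚᵘ-mono-< i<j))))

fromℤ-+ : ∀ i j → fromℤ (i ℤ.+ j) ≡ fromℤ i + fromℤ j
fromℤ-+ i j = toℚᵘ-injective (ℚᵘ.≃-trans (fromℤ-toℚᵘ (i ℤ.+ j))
  (ℚᵘ.≃-trans (ℚᵘ.*≡* (cong (ℤ._* + 1) (cong₂ ℤ._+_ (sym (ℤ.*-identityʳ i)) (sym (ℤ.*-identityʳ j)))))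
  (ℚᵘ.≃-sym (ℚᵘ.≃-trans (toℚᵘ-homo-+ (fromℤ i) (fromℤ j))
    (ℚᵘ.+-cong (fromℤ-toℚᵘ i) (fromℤ-toℚᵘ j))))))

fromℤ-* : ∀ i j → fromℤ (i ℤ.* j) ≡ fromℤ i * fromℤ j
fromℤ-* i j = toℚᵘ-injective (ℚᵘ.≃-trans (fromℤ-toℚᵘ (i ℤ.* j))
  (ℚᵘ.≃-sym (ℚᵘ.≃-trans (toℚᵘ-homo-* (fromℤ i) (fromℤ j))
    (ℚᵘ.*-cong (fromℤ-toℚᵘ i) (fromℤ-toℚᵘ j)))))

fromℤ-pos : ∀ n .{{_ : ℕ.NonZero n}} → Positive (fromℤ (+ n))
fromℤ-pos n = normalize-pos n 1

/-as-* : ∀ n .{{_ : ℕ.NonZero n}} → fromℤ (+ n) * (+ 1 / n) ≡ 1ℚ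
/-as-* n@(suc n-1) = toℚᵘ-injective (ℚᵘ.≃-trans (toℚᵘ-homo-* (fromℤ (+ n)) (+ 1 / n))
  (ℚᵘ.≃-trans (ℚᵘ.*-cong (fromℤ-toℚᵘ (+ n)) (toℚᵘ-fromℚᵘ (ℚᵘ.mkℚᵘ (+ 1) n-1)))
  (ℚᵘ.*≡* (trans (ℤ.*-identityʳ _) (trans (ℤ.*-identityʳ (+ n)) (sym (trans (ℤ.*-identityˡ _) (ℤ.*-identityˡ (+ n)))))))))

floor≤ : ∀ q → fromℤ (floor q) ≤ q
floor≤ q@record{} = toℚᵘ-cancel-≤ (ℚᵘ.≤-respˡ-≃ (ℚᵘ.≃-sym (fromℤ-toℚᵘ (floor q)))
  (ℚᵘ.*≤* (subst (floor q ℤ.* ↧ q ℤ.≤_) (sym (ℤ.*-identityʳ (↥ q))) (ℤ.[n/d]*d≤n (↥ q) (↧ q)))))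

<floor+1 : ∀ q → q < fromℤ (floor q) + 1ℚ
<floor+1 q@record{} = subst (q <_) (trans (cong fromℤ (ℤ.+-comm (+ 1) (floor q))) (fromℤ-+ (floor q) (+ 1)))
  (toℚᵘ-cancel-< (ℚᵘ.<-respʳ-≃ (ℚᵘ.≃-sym (fromℤ-toℚᵘ (ℤ.suc (floor q))))
    (ℚᵘ.*<* (subst₂ ℤ._<_ (sym (ℤ.*-identityʳ (↥ q)))
       (cong (λ z → ℤ.suc z ℤ.* ↧ q) (sym (ℤ.div-pos-is-/ℕ (↥ q) (↧ₙ q))))
       (ℤ.n<s[n/ℕd]*d (↥ q) (↧ₙ q))))))

p≤q⇒0≤q-p : ∀ {p q} → p ≤ q → 0ℚ ≤ q - p
p≤q⇒0≤q-p {p} {q} p≤q = subst (_≤ q - p) (+-inverseʳ p) (+-monoˡ-≤ (- p) p≤q)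

-- Reduces p ≤ q to a ≤ b when q - p ≡ b - a; the equation is left to the ring solver.
≤-via : ∀ {a b p q} → a ≤ b → q - p ≡ b - a → p ≤ q
≤-via {a} {b} {p} {q} a≤b eq = subst₂ _≤_ (+-identityʳ p)
  (solve 2 (λ p q → p :+ (q :- p) := q) refl p q)
  (+-monoʳ-≤ p (subst (0ℚ ≤_) (sym eq) (p≤q⇒0≤q-p a≤b)))

p≤∣p∣ : ∀ p → p ≤ ∣ p ∣
p≤∣p∣ p = [ (λ 0≤p → ≤-reflexive (sym (0≤p⇒∣p∣≡p 0≤p))) , (λ p≤0 → ≤-trans p≤0 (0≤∣p∣ p)) ]′ (≤-total 0ℚ p)

-p≤∣p∣ : ∀ p → - p ≤ ∣ p ∣
-p≤∣p∣ p = subst (- p ≤_) (∣-p∣≡∣p∣ p) (p≤∣p∣ (- p))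

∣p∣≤ : ∀ {p b} → p ≤ b → - p ≤ b → ∣ p ∣ ≤ b
∣p∣≤ {p} p≤b -p≤b = [ (λ eq → subst (_≤ _) (sym eq) p≤b) , (λ eq → subst (_≤ _) (sym eq) -p≤b) ]′ (∣p∣≡p∨∣p∣≡-p p)

∣p-q∣≡∣q-p∣ : ∀ p q → ∣ p - q ∣ ≡ ∣ q - p ∣
∣p-q∣≡∣q-p∣ p q = trans (sym (∣-p∣≡∣p∣ (p - q))) (cong ∣_∣ (solve 2 (λ p q → :- (p :- q) := q :- p) refl p q))

c*a≤b⇒c/b≤1/a : ∀ c a b .{{_ : ℕ.NonZero a}} .{{_ : ℕ.NonZero b}} →
                c ℕ.* a ℕ.≤ b → fromℤ (+ c) * (+ 1 / b) ≤ + 1 / a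
c*a≤b⇒c/b≤1/a c a b ca≤b = *-cancelʳ-≤-pos (A * B) {{pos*pos⇒pos A {{fromℤ-pos a}} B {{fromℤ-pos b}}}}
  (subst₂ _≤_
    (trans (trans (cong fromℤ (ℤ.pos-* c a)) (fromℤ-* (+ c) (+ a)))
      (trans (sym (*-identityʳ (C * A))) (trans (cong (C * A *_) (sym (/-as-* b)))
        (solve 4 (λ c a b b′ → c :* a :* (b :* b′) := c :* b′ :* (a :* b)) refl C A B (+ 1 / b)))))
    (trans (sym (*-identityʳ B)) (trans (cong (B *_) (sym (/-as-* a)))
      (solve 3 (λ a b a′ → b :* (a :* a′) := a′ :* (a :* b)) refl A B (+ 1 / a))))
    (fromℤ-mono-≤ (ℤ.+≤+ ca≤b)))
  where
  A = fromℤ (+ a)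
  B = fromℤ (+ b)
  C = fromℤ (+ c)

archimedean : ∀ {ε} → 0ℚ < ε → ∃ λ M → + 1 / suc M ≤ ε
archimedean {mkℚ (+ 0) d c} 0<ε with () ← positive 0<ε
archimedean {mkℚ ℤ.-[1+ n ] d c} 0<ε with () ← positive 0<ε
archimedean {ε@(mkℚ (+ suc n) d c)} 0<ε = d , toℚᵘ-cancel-≤
  (ℚᵘ.≤-respˡ-≃ (ℚᵘ.≃-sym (toℚᵘ-fromℚᵘ (ℚᵘ.mkℚᵘ (+ 1) d)))
    (ℚᵘ.*≤* (ℤ.*-monoʳ-≤-nonNeg (+ suc d) {+ 1} {+ suc n} (ℤ.+≤+ (s≤s z≤n)))))

0<½ε : ∀ {ε} → 0ℚ < ε → 0ℚ < ½ * ε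
0<½ε {ε} 0<ε = positive⁻¹ (½ * ε) {{pos*pos⇒pos ½ ε {{positive 0<ε}}}}

½ε+½ε≡ε : ∀ ε → ½ * ε + ½ * ε ≡ ε
½ε+½ε≡ε ε = trans (sym (*-distribʳ-+ ε ½ ½)) (*-identityˡ ε)

-- The distance to the nearest integer, as distℤ-attained and distℤ-least show.
distℤ : ℚ → ℚ
distℤ q = (q - fromℤ (floor q)) ⊓ (fromℤ (floor q) + 1ℚ - q)

distℤ-attained : ∀ q → ∃ λ k → distℤ q ≡ ∣ q - fromℤ k ∣
distℤ-attained q = [ (λ eq → floor q , trans eq below) , (λ eq → floor q ℤ.+ + 1 , trans eq above) ]′
  (⊓-sel (q - fromℤ (floor q)) (fromℤ (floor q) + 1ℚ - q))
  where
  below : q - fromℤ (floor q) ≡ ∣ q - fromℤ (floor q) ∣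
  below = sym (0≤p⇒∣p∣≡p (p≤q⇒0≤q-p (floor≤ q)))

  above : fromℤ (floor q) + 1ℚ - q ≡ ∣ q - fromℤ (floor q ℤ.+ + 1) ∣
  above = trans (sym (0≤p⇒∣p∣≡p (p≤q⇒0≤q-p (<⇒≤ (<floor+1 q)))))
    (trans (∣p-q∣≡∣q-p∣ (fromℤ (floor q) + 1ℚ) q)
      (cong (λ z → ∣ q - z ∣) (sym (fromℤ-+ (floor q) (+ 1)))))

distℤ-least : ∀ q k → distℤ q ≤ ∣ q - fromℤ k ∣
distℤ-least q k = case k ℤ.≤? floor q of λ where
    (yes k≤f) → below k≤f
    (no  k≰f) → above (ℤ.≰⇒> k≰f)
  where
  below : k ℤ.≤ floor q → distℤ q ≤ ∣ q - fromℤ k ∣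
  below k≤f = ≤-trans (p⊓q≤p (q - fromℤ (floor q)) (fromℤ (floor q) + 1ℚ - q))
    (≤-trans (+-monoʳ-≤ q (neg-antimono-≤ (fromℤ-mono-≤ k≤f))) (p≤∣p∣ (q - fromℤ k)))

  above : floor q ℤ.< k → distℤ q ≤ ∣ q - fromℤ k ∣
  above f<k = ≤-trans (p⊓q≤q (q - fromℤ (floor q)) (fromℤ (floor q) + 1ℚ - q))
    (≤-trans (+-monoˡ-≤ (- q) (subst (_≤ fromℤ k)
        (trans (cong fromℤ (ℤ.+-comm (+ 1) (floor q))) (fromℤ-+ (floor q) (+ 1)))
        (fromℤ-mono-≤ (ℤ.i<j⇒suc[i]≤j f<k))))
      (≤-trans (p≤∣p∣ (fromℤ k - q)) (≤-reflexive (∣p-q∣≡∣q-p∣ (fromℤ k) q))))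

-- Cauchy reals; no quotient is taken, and equality is not needed below.
record ℝ : Set where
  field
    seq    : ℕ → ℚ
    cauchy : ∀ {ε} → 0ℚ < ε →
             ∃ λ M → ∀ {m n} → M ℕ.≤ m → M ℕ.≤ n → ∣ seq m - seq n ∣ ≤ ε

open ℝ public

infix  4 _≤ℝ_ _<ℝ_
infixl 6 _+ℝ_ _-ℝ_
infixl 7 _·_
infix  8 -ℝ_

_≤ℝ_ : ℝ → ℝ → Set
x ≤ℝ y = ∀ {ε} → 0ℚ < ε → ∃ λ M → ∀ {n} → M ℕ.≤ n → seq x n ≤ seq y n + ε

_<ℝ_ : ℝ → ℝ → Set
x <ℝ y = ∃ λ ε → 0ℚ < ε × ∃ λ M → ∀ {n} → M ℕ.≤ n → seq x n + ε ≤ seq y n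

fromℚ : ℚ → ℝ
fromℚ q = record
  { seq    = λ _ → q
  ; cauchy = λ 0<ε → 0 , λ _ _ → ≤-trans (≤-reflexive (cong ∣_∣ (+-inverseʳ q))) (<⇒≤ 0<ε)
  }

0ℝ : ℝ
0ℝ = fromℚ 0ℚ

_+ℝ_ : ℝ → ℝ → ℝ
x +ℝ y = record
  { seq    = λ n → seq x n + seq y n
  ; cauchy = λ {ε} 0<ε →
      let (M₁ , p₁) = cauchy x (0<½ε 0<ε)
          (M₂ , p₂) = cauchy y (0<½ε 0<ε)
      in M₁ ℕ.⊔ M₂ , λ {m} {n} M≤m M≤n →
           ≤-trans (subst (_≤ ∣ seq x m - seq x n ∣ + ∣ seq y m - seq y n ∣)
                     (cong ∣_∣ (solve 4 (λ a b c d → a :- b :+ (c :- d) := a :+ c :- (b :+ d)) refl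
                       (seq x m) (seq x n) (seq y m) (seq y n)))
                     (∣p+q∣≤∣p∣+∣q∣ (seq x m - seq x n) (seq y m - seq y n)))
             (subst (∣ seq x m - seq x n ∣ + ∣ seq y m - seq y n ∣ ≤_) (½ε+½ε≡ε ε)
               (+-mono-≤ (p₁ (ℕ.m⊔n≤o⇒m≤o M₁ M₂ M≤m) (ℕ.m⊔n≤o⇒m≤o M₁ M₂ M≤n))
                         (p₂ (ℕ.m⊔n≤o⇒n≤o M₁ M₂ M≤m) (ℕ.m⊔n≤o⇒n≤o M₁ M₂ M≤n))))
  }

_·_ : ℚ → ℝ → ℝ
c · x = record
  { seq    = λ n → c * seq x n
  ; cauchy = λ {ε} 0<ε →
      let (M , p) = cauchy x (δ-pos 0<ε)
      in M , λ {m} {n} M≤m M≤n →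
           subst₂ _≤_ (trans (sym (∣p*q∣≡∣p∣*∣q∣ c (seq x m - seq x n)))
                        (cong ∣_∣ (solve 3 (λ c a b → c :* (a :- b) := c :* a :- c :* b) refl c (seq x m) (seq x n))))
             refl
             (≤-trans (*-monoˡ-≤-nonNeg ∣ c ∣ {{∣-∣-nonNeg c}} (p M≤m M≤n)) (cδ≤ε 0<ε))
  }
  where
  d = ∣ c ∣ + 1ℚ
  instance
    d-pos : Positive d
    d-pos = nonNeg+pos⇒pos ∣ c ∣ {{∣-∣-nonNeg c}} 1ℚ
    d-nonZero : NonZero d
    d-nonZero = pos⇒nonZero d

  δ : ℚ → ℚ
  δ ε = 1/ d * ε

  δ-pos : ∀ {ε} → 0ℚ < ε → 0ℚ < δ ε
  δ-pos {ε} 0<ε = positive⁻¹ (δ ε) {{pos*pos⇒pos (1/ d) {{1/pos⇒pos d}} ε {{positive 0<ε}}}}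

  cδ≤ε : ∀ {ε} → 0ℚ < ε → ∣ c ∣ * δ ε ≤ ε
  cδ≤ε {ε} 0<ε = ≤-trans
    (*-monoʳ-≤-nonNeg (δ ε) {{nonNegative (<⇒≤ (δ-pos 0<ε))}}
      (≤-via {0ℚ} {1ℚ} {∣ c ∣} {d} (<⇒≤ (positive⁻¹ 1ℚ)) (solve 1 (λ a → a :+ con 1ℚ :- a := con 1ℚ :- con 0ℚ) refl ∣ c ∣)))
    (≤-reflexive (trans (sym (*-assoc d (1/ d) ε)) (trans (cong (_* ε) (*-inverseʳ d)) (*-identityˡ ε))))

-- Extends a 1-Lipschitz function from ℚ to ℝ by continuity.
extend : (f : ℚ → ℚ) → (∀ p q → f p ≤ f q + ∣ p - q ∣) → ℝ → ℝ
extend f lip x = record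
  { seq    = λ n → f (seq x n)
  ; cauchy = λ 0<ε →
      let (M , p) = cauchy x 0<ε
      in M , λ {m} {n} M≤m M≤n → ∣p∣≤
           (≤-via (≤-trans (lip (seq x m) (seq x n)) (+-monoʳ-≤ (f (seq x n)) (p M≤m M≤n)))
             (solve 3 (λ a b e → e :- (a :- b) := b :+ e :- a) refl (f (seq x m)) (f (seq x n)) _))
           (≤-via (≤-trans (lip (seq x n) (seq x m)) (+-monoʳ-≤ (f (seq x m)) (p M≤n M≤m)))
             (solve 3 (λ a b e → e :- :- (a :- b) := a :+ e :- b) refl (f (seq x m)) (f (seq x n)) _))
  }

-ℝ_ : ℝ → ℝ
-ℝ_ = extend -_ λ p q → ≤-via (-p≤∣p∣ (p - q))
  (solve 3 (λ p q a → :- q :+ a :- :- p := a :- :- (p :- q)) refl p q ∣ p - q ∣)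

_-ℝ_ : ℝ → ℝ → ℝ
x -ℝ y = x +ℝ (-ℝ y)

∣_∣ℝ : ℝ → ℝ
∣_∣ℝ = extend ∣_∣ λ p q → subst (λ z → ∣ z ∣ ≤ ∣ q ∣ + ∣ p - q ∣)
  (solve 2 (λ p q → q :+ (p :- q) := p) refl p q) (∣p+q∣≤∣p∣+∣q∣ q (p - q))

‖_‖ : ℝ → ℝ
‖_‖ = extend distℤ λ p q →
  let (k , dq) = distℤ-attained q
      pk = subst (λ z → ∣ z ∣ ≤ ∣ q - fromℤ k ∣ + ∣ p - q ∣)
             (solve 3 (λ p q k → q :- k :+ (p :- q) := p :- k) refl p q (fromℤ k))
             (∣p+q∣≤∣p∣+∣q∣ (q - fromℤ k) (p - q))
  in ≤-trans (distℤ-least p k) (subst (λ z → ∣ p - fromℤ k ∣ ≤ z + ∣ p - q ∣) (sym dq) pk)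

-- Constructively not every real has a floor, so it is supplied as evidence.
record Floor (x : ℝ) : Set where
  field
    ⌊x⌋     : ℤ
    ⌊x⌋≤x   : fromℚ (fromℤ ⌊x⌋) ≤ℝ x
    x<⌊x⌋+1 : x <ℝ fromℚ (fromℤ ⌊x⌋ + 1ℚ)

record [0,1⟩ : Set where
  field
    value   : ℝ
    0≤value : 0ℝ ≤ℝ value
    value<1 : value <ℝ fromℚ 1ℚ

open [0,1⟩ public

fractionalPart : (x : ℝ) → Floor x → [0,1⟩
fractionalPart x fl = record
  { value   = x -ℝ fromℚ (fromℤ ⌊x⌋)
  ; 0≤value = λ {ε} 0<ε →
      let (M , p) = ⌊x⌋≤x 0<ε
      in M , λ {n} M≤n → ≤-via (p M≤n)
           (solve 3 (λ x k e → x :- k :+ e :- con 0ℚ := x :+ e :- k) refl (seq x n) (fromℤ ⌊x⌋) ε)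
  ; value<1 =
      let (ε , 0<ε , M , p) = x<⌊x⌋+1
      in ε , 0<ε , M , λ {n} M≤n → ≤-via (p M≤n)
           (solve 3 (λ x k e → con 1ℚ :- (x :- k :+ e) := k :+ con 1ℚ :- (x :+ e)) refl (seq x n) (fromℤ ⌊x⌋) ε)
  }
  where open Floor fl

-- A relation rather than a function of P, since P need not be decidable;
-- at most one c satisfies it, and classically exactly one when P is finite.
HasCardinality : {A : Set} → (A → Set) → ℕ → Set
HasCardinality {A} P c = Σ (List A) λ as → Unique as × (∀ a → a ∈ as ⇔ P a) × length as ≡ c

ClosePair : (ℕ → [0,1⟩) → ℝ → (N : ℕ) .{{_ : ℕ.NonZero N}} → ℕ × ℕ → Set
ClosePair x s N (l , m) =
  (1 ℕ.≤ l × l ℕ.≤ N) × (1 ℕ.≤ m × m ℕ.≤ N) × l ≢ m ×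
  ‖ value (x l) -ℝ value (x m) ‖ ≤ℝ (+ 1 / N) · s

PoissonianPairCorrelations : (ℕ → [0,1⟩) → Set
PoissonianPairCorrelations x =
  ∀ s → 0ℝ ≤ℝ s →
  ∀ {ε} → 0ℚ < ε → ∃ λ N₀ → ∀ N .{{_ : ℕ.NonZero N}} → N₀ ℕ.≤ N →
  ∀ c → HasCardinality (ClosePair x s N) c →
  ∣ fromℚ (+ c / N) -ℝ fromℤ (+ 2) · s ∣ℝ ≤ℝ fromℚ ε

-- Summation starts at index 1.
partialSum : (ℕ → ℚ) → ℕ → ℚ
partialSum f zero    = 0ℚ
partialSum f (suc n) = partialSum f n + f (suc n)

D : ℕ → ℕ
D m = 3 ℕ.^ m ℕ.* 2 ℕ.^ (3 ℕ.^ m)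

D≢0 : ∀ m → ℕ.NonZero (D m)
D≢0 m = ℕ.m*n≢0 (3 ℕ.^ m) (2 ℕ.^ (3 ℕ.^ m)) {{ℕ.m^n≢0 3 m}} {{ℕ.m^n≢0 2 (3 ℕ.^ m)}}

term : ℕ → ℚ
term m = (+ 1 / D m) {{D≢0 m}}

S : ℕ → ℚ
S = partialSum term

E : ℕ → ℕ
E m = 3 ℕ.* (2 ℕ.^ (3 ℕ.^ m) ℕ.* 2 ℕ.^ (3 ℕ.^ m))

D-suc : ∀ m → D (suc m) ≡ E m ℕ.* D m
D-suc m = trans (cong (3 ℕ.* a ℕ.*_) (trans (ℕ.^-distribˡ-+-* 2 a (a ℕ.+ (a ℕ.+ 0)))
    (cong (b ℕ.*_) (trans (ℕ.^-distribˡ-+-* 2 a (a ℕ.+ 0)) (cong (λ z → b ℕ.* 2 ℕ.^ z) (ℕ.+-identityʳ a))))))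
  (ℕ-solve 2 (λ a b → ℕcon 3 ⊗ a ⊗ (b ⊗ (b ⊗ b)) ⊜ ℕcon 3 ⊗ (b ⊗ b) ⊗ (a ⊗ b)) refl a b)
  where
  a = 3 ℕ.^ m
  b = 2 ℕ.^ a

n<3^n : ∀ n → n ℕ.< 3 ℕ.^ n
n<3^n zero    = s≤s z≤n
n<3^n (suc n) = ℕ.≤-trans (s≤s (n<3^n n)) (ℕ.+-mono-≤ (ℕ.m^n>0 3 n) (ℕ.m≤m+n (3 ℕ.^ n) (3 ℕ.^ n ℕ.+ 0)))

2^n*D≤D : ∀ n → 2 ℕ.^ n ℕ.* 4 ℕ.* D n ℕ.≤ D (suc n)
2^n*D≤D n = subst (2 ℕ.^ n ℕ.* 4 ℕ.* D n ℕ.≤_) (sym (D-suc n)) (ℕ.*-monoˡ-≤ (D n)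
  (ℕ.≤-trans (subst₂ ℕ._≤_ (ℕ.^-distribˡ-+-* 2 n 2) (ℕ.^-distribˡ-+-* 2 (3 ℕ.^ n) (3 ℕ.^ n))
                (ℕ.^-monoʳ-≤ 2 (exponents n)))
    (ℕ.m≤m+n (2 ℕ.^ (3 ℕ.^ n) ℕ.* 2 ℕ.^ (3 ℕ.^ n)) _)))
  where
  exponents : ∀ n → n ℕ.+ 2 ℕ.≤ 3 ℕ.^ n ℕ.+ 3 ℕ.^ n
  exponents n = ℕ.≤-trans (subst (ℕ._≤ suc n ℕ.+ suc n) (ℕ.+-comm 2 n) (s≤s (ℕ.≤-trans (s≤s (ℕ.m≤m+n n n)) (ℕ.≤-reflexive (sym (ℕ.+-suc n n))))))
    (ℕ.+-mono-≤ (n<3^n n) (n<3^n n))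

0≤term : ∀ m → 0ℚ ≤ term m
0≤term m = <⇒≤ (positive⁻¹ (term m) {{normalize-pos 1 (D m) {{D≢0 m}}}})

2*term≤term : ∀ m → fromℤ (+ 2) * term (suc m) ≤ term m
2*term≤term m = c*a≤b⇒c/b≤1/a 2 (D m) (D (suc m)) {{D≢0 m}} {{D≢0 (suc m)}}
  (ℕ.≤-trans (ℕ.*-monoˡ-≤ (D m) (ℕ.≤-trans (s≤s (s≤s (z≤n {2}))) (ℕ.m≤n*m 4 (2 ℕ.^ m) {{ℕ.m^n≢0 2 m}}))) (2^n*D≤D m))

S-mono : ∀ {m n} → m ℕ.≤ n → S m ≤ S n
S-mono m≤n = go (ℕ.≤⇒≤′ m≤n)
  where
  go : ∀ {m n} → m ℕ.≤′ n → S m ≤ S n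
  go ℕ.≤′-refl = ≤-refl
  go {m} {suc n} (ℕ.≤′-step m≤n) = ≤-trans (go m≤n)
    (subst (_≤ S (suc n)) (+-identityʳ (S n)) (+-monoʳ-≤ (S n) (0≤term (suc n))))

tail : ℕ → ℚ
tail m = fromℤ (+ 2) * term (suc m)

0≤tail : ∀ m → 0ℚ ≤ tail m
0≤tail m = *-monoˡ-≤-nonNeg (fromℤ (+ 2)) {0ℚ} {term (suc m)} (0≤term (suc m))

S+tail-anti : ∀ {m n} → m ℕ.≤ n → S n + tail n ≤ S m + tail m
S+tail-anti m≤n = go (ℕ.≤⇒≤′ m≤n)
  where
  go : ∀ {m n} → m ℕ.≤′ n → S n + tail n ≤ S m + tail m
  go ℕ.≤′-refl = ≤-refl
  go {m} {suc n} (ℕ.≤′-step m≤n) = ≤-trans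
    (≤-via (2*term≤term (suc n))
      (solve 3 (λ s t u → s :+ con (fromℤ (+ 2)) :* t :- (s :+ t :+ u) := t :- u) refl (S n) (term (suc n)) (tail (suc n))))
    (go m≤n)

S-tail : ∀ {m n} → m ℕ.≤ n → S n ≤ S m + tail m
S-tail {m} {n} m≤n = ≤-trans
  (subst (_≤ S n + tail n) (+-identityʳ (S n)) (+-monoʳ-≤ (S n) (0≤tail n)))
  (S+tail-anti m≤n)

tail-small : ∀ m → tail m ≤ + 1 / suc m
tail-small m = c*a≤b⇒c/b≤1/a 2 (suc m) (D (suc m)) {{_}} {{D≢0 (suc m)}} (ℕ.≤-trans
  (ℕ.≤-reflexive (ℕ.*-comm 2 (suc m)))
  (ℕ.*-mono-≤ (ℕ.<⇒≤ (n<3^n (suc m))) (ℕ.^-monoʳ-≤ 2 (ℕ.m^n>0 3 (suc m)))))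

α₂,₃ : ℝ
α₂,₃ = record
  { seq    = partialSum term
  ; cauchy = λ {ε} 0<ε →
      let (M , p) = archimedean 0<ε
          bound : ∀ {k} → M ℕ.≤ k → S k ≤ S M + ε
          bound M≤k = ≤-trans (S-tail M≤k) (+-monoʳ-≤ (S M) (≤-trans (tail-small M) p))
      in M , λ {m} {n} M≤m M≤n → ∣p∣≤
           (≤-via (+-mono-≤ (bound M≤m) (S-mono M≤n))
             (solve 4 (λ a b c e → e :- (a :- b) := c :+ e :+ b :- (a :+ c)) refl (S m) (S n) (S M) ε))
           (≤-via (+-mono-≤ (bound M≤n) (S-mono M≤m))
             (solve 4 (λ a b c e → e :- :- (a :- b) := c :+ e :+ a :- (b :+ c)) refl (S m) (S n) (S M) ε))
  }

-- D clears the denominators of S; hence 2ⁿ S n misses the next integer by at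
-- least 1 / D n, which exceeds 2ⁿ times the remainder of the series.
D*S-integral : ∀ m → ∃ λ z → fromℤ z ≡ fromℤ (+ D m) * S m
D*S-integral zero    = + 0 , refl
D*S-integral (suc m) =
  let (z , eq) = D*S-integral m in
  + E m ℤ.* z ℤ.+ + 1 , (begin
    fromℤ (+ E m ℤ.* z ℤ.+ + 1)
      ≡⟨ fromℤ-+ (+ E m ℤ.* z) (+ 1) ⟩
    fromℤ (+ E m ℤ.* z) + 1ℚ
      ≡⟨ cong (_+ 1ℚ) (trans (fromℤ-* (+ E m) z) (cong (fromℤ (+ E m) *_) eq)) ⟩
    fromℤ (+ E m) * (fromℤ (+ D m) * S m) + 1ℚ
      ≡⟨ cong (_+ 1ℚ) (sym (*-assoc (fromℤ (+ E m)) (fromℤ (+ D m)) (S m))) ⟩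
    fromℤ (+ E m) * fromℤ (+ D m) * S m + 1ℚ
      ≡⟨ cong₂ (λ d o → d * S m + o) D-suc-ℚ (sym (/-as-* (D (suc m)) {{D≢0 (suc m)}})) ⟩
    fromℤ (+ D (suc m)) * S m + fromℤ (+ D (suc m)) * term (suc m)
      ≡⟨ sym (*-distribˡ-+ (fromℤ (+ D (suc m))) (S m) (term (suc m))) ⟩
    fromℤ (+ D (suc m)) * S (suc m) ∎)
  where
  open ≡-Reasoning
  D-suc-ℚ : fromℤ (+ E m) * fromℤ (+ D m) ≡ fromℤ (+ D (suc m))
  D-suc-ℚ = sym (trans (cong (fromℤ ∘ +_) (D-suc m))
    (trans (cong fromℤ (ℤ.pos-* (E m) (D m))) (fromℤ-* (+ E m) (+ D m))))

gap : ∀ d .{{_ : ℕ.NonZero d}} z u → fromℤ z ≡ fromℤ (+ d) * u →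
      u + + 1 / d ≤ fromℤ (floor u) + 1ℚ
gap d z u eq = *-cancelˡ-≤-pos d′ {{fromℤ-pos d}} (subst₂ _≤_ left right (fromℤ-mono-≤ (ℤ.i<j⇒suc[i]≤j z<w)))
  where
  d′ = fromℤ (+ d)
  w  = + d ℤ.* (floor u ℤ.+ + 1)

  right : fromℤ w ≡ d′ * (fromℤ (floor u) + 1ℚ)
  right = trans (fromℤ-* (+ d) (floor u ℤ.+ + 1)) (cong (d′ *_) (fromℤ-+ (floor u) (+ 1)))

  z<w : z ℤ.< w
  z<w = fromℤ-cancel-< (subst₂ _<_ (sym eq) (sym right) (*-monoʳ-<-pos d′ {{fromℤ-pos d}} (<floor+1 u)))

  left : fromℤ (ℤ.suc z) ≡ d′ * (u + + 1 / d)
  left = trans (fromℤ-+ (+ 1) z) (trans (+-comm 1ℚ (fromℤ z))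
    (trans (cong₂ _+_ eq (sym (/-as-* d))) (sym (*-distribˡ-+ d′ u (+ 1 / d)))))

floor-2^n·α₂,₃ : ∀ n → Floor (fromℤ (+ (2 ℕ.^ n)) · α₂,₃)
floor-2^n·α₂,₃ n = record
  { ⌊x⌋     = floor u
  ; ⌊x⌋≤x   = λ {ε} 0<ε → n , λ {k} n≤k →
      ≤-trans (floor≤ u) (≤-trans (*-monoˡ-≤-nonNeg P {{P≥0}} (S-mono n≤k))
        (subst (_≤ P * S k + ε) (+-identityʳ (P * S k)) (+-monoʳ-≤ (P * S k) (<⇒≤ 0<ε))))
  ; x<⌊x⌋+1 = δ , positive⁻¹ δ {{pos*pos⇒pos P (tail n) {{tail>0}}}} , n , λ {k} n≤k →
      ≤-trans (≤-via (*-monoˡ-≤-nonNeg P {{P≥0}} (S-tail n≤k))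
          (solve 4 (λ p s t s′ → p :* s :+ (p :* t :+ p :* t) :- (p :* s′ :+ p :* t) := p :* (s :+ t) :- p :* s′) refl
            P (S n) (tail n) (S k)))
        (≤-trans (+-monoʳ-≤ u 2δ≤1/D) (gap (D n) {{D≢0 n}} (proj₁ integral) u (proj₂ integral)))
  }
  where
  P = fromℤ (+ (2 ℕ.^ n))
  u = P * S n
  δ = P * tail n

  instance
    P>0 : Positive P
    P>0 = fromℤ-pos (2 ℕ.^ n) {{ℕ.m^n≢0 2 n}}

  P≥0 : NonNegative P
  P≥0 = pos⇒nonNeg P

  tail>0 : Positive (tail n)
  tail>0 = pos*pos⇒pos (fromℤ (+ 2)) (term (suc n)) {{normalize-pos 1 (D (suc n)) {{D≢0 (suc n)}}}}

  integral : ∃ λ z → fromℤ z ≡ fromℤ (+ D n) * u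
  integral =
    let (z , eq) = D*S-integral n
    in + (2 ℕ.^ n) ℤ.* z ,
       trans (fromℤ-* (+ (2 ℕ.^ n)) z) (trans (cong (P *_) eq)
         (solve 3 (λ p d s → p :* (d :* s) := d :* (p :* s)) refl P (fromℤ (+ D n)) (S n)))

  2δ≤1/D : δ + δ ≤ term n
  2δ≤1/D = subst (_≤ term n)
    (trans (cong (_* term (suc n)) (trans (cong fromℤ (ℤ.pos-* (2 ℕ.^ n) 4)) (fromℤ-* (+ (2 ℕ.^ n)) (+ 4))))
      (solve 2 (λ p t → p :* con (fromℤ (+ 4)) :* t := p :* (con (fromℤ (+ 2)) :* t) :+ p :* (con (fromℤ (+ 2)) :* t)) refl
        P (term (suc n))))
    (c*a≤b⇒c/b≤1/a (2 ℕ.^ n ℕ.* 4) (D n) (D (suc n)) {{D≢0 n}} {{D≢0 (suc n)}} (2^n*D≤D n))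

{-# OPTIONS --safe #-}

-- For m ≥ 1 put N = 3^(m+2) and p = 2·3^m. For N/3 ≤ n < N - p the number 2ⁿ α₂,₃
-- is, up to a tiny error, a fraction with denominator N/3, and 2ᵖ ≡ 1 modulo N/3 makes
-- these fractions p-periodic modulo 1. Hence x_{l+p} is within 1/(18N) of x_l for the
-- p = 2N/9 indices N/3 ≤ l < N/3 + p, so F_N(1/18) ≥ 2/9 although 2s = 1/9.
module Submission where

open import Defs
open import Data.Empty using (⊥)
open import Data.Fin.Base using (Fin; toℕ)
open import Data.Fin.Properties using (toℕ<n; toℕ-injective; injective⇒≤)
open import Data.Integer.Base as ℤ using (+_)
import Data.Integer.Properties as ℤ
open import Data.List.Base using (filter; upTo; cartesianProduct)
import Data.List.Membership.DecPropositional as DecMembership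
open import Data.List.Membership.Propositional using (_∈_)
open import Data.List.Membership.Propositional.Properties
  using (∈-filter⁺; ∈-filter⁻; ∈-upTo⁺; ∈-cartesianProduct⁺)
open import Data.List.Membership.Setoid.Properties using (index-injective)
open import Data.List.Relation.Unary.All as All using (All)
open import Data.List.Relation.Unary.Any using (index)
open import Data.List.Relation.Unary.Unique.Propositional using (Unique)
import Data.List.Relation.Unary.Unique.Propositional.Properties as Unique
open import Data.Nat.Base as ℕ using (ℕ; zero; suc; _^_; z≤n; s≤s)
import Data.Nat.Properties as ℕ
import Data.Nat.Solver as ℕ
open import Data.Product using (∃; _×_; _,_; proj₁; proj₂)
open import Data.Product.Properties using (≡-dec)
open import Data.Rational.Base
open import Data.Rational.Properties
open import Data.Rational.Solver using (module +-*-Solver)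
import Data.Rational.Unnormalised.Base as ℚᵘ
import Data.Rational.Unnormalised.Properties as ℚᵘ
open import Function.Base using (_∘_)
open import Function.Bundles using (Equivalence; mk⇔)
open import Function.Definitions using (Injective)
open import Level using (0ℓ)
open import Relation.Binary.Definitions using (DecidableEquality)
open import Relation.Binary.PropositionalEquality
open import Relation.Nullary.Decidable.Core
  using (Dec; yes; no; from-yes; ¬¬-excluded-middle)
open import Relation.Nullary.Negation using (¬_; ¬¬-Monad; ¬¬-map)

open ℕ.+-*-Solver using ()
  renaming (solve to ℕ-solve; _:+_ to _⊕_; _:*_ to _⊗_; _:=_ to _⊜_; con to ℕcon)
open +-*-Solver using (solve; _:+_; _:*_; _:-_; _:=_; con)

-- Cardinalities of finite sets that need not be decidable

-- Excluded middle for a single proposition is irrefutable, and double negation commutes with finite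
-- conjunctions. So `P` may be assumed decidable along all of `xs` at once, and filtering `xs` then
-- lists exactly the elements satisfying `P`.
¬¬-hasCardinality : ∀ {A : Set} → DecidableEquality A → (P : A → Set) →
                    ∀ {xs} → Unique xs → (∀ {a} → P a → a ∈ xs) →
                    ¬ ¬ ∃ (HasCardinality P)
¬¬-hasCardinality {A} _≟_ P {xs} xs! P⊆xs =
  ¬¬-map enumerate (All.sequenceM 0ℓ ¬¬-Monad (All.universal (λ _ → ¬¬-excluded-middle) xs))
  where
  open DecMembership _≟_ using (_∈?_)

  enumerate : All (Dec ∘ P) xs → ∃ (HasCardinality P)
  enumerate decs = _ , filter P? xs , Unique.filter⁺ P? xs! ,
    (λ a → mk⇔ (proj₂ ∘ ∈-filter⁻ P? {xs = xs}) λ Pa → ∈-filter⁺ P? (P⊆xs Pa) Pa) , refl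
    where
    P? : ∀ a → Dec (P a)
    P? a with a ∈? xs
    ... | yes a∈xs = All.lookup decs a∈xs
    ... | no  a∉xs = no (a∉xs ∘ P⊆xs)

-- Sending `i` to the position of `f i` in the list is again injective, since equal positions hold
-- equal elements; the pigeonhole principle on `Fin` concludes.
injection⇒≤cardinality : ∀ {A : Set} {P : A → Set} {c n} (f : Fin n → A) →
                         Injective _≡_ _≡_ f → (∀ i → P (f i)) → HasCardinality P c → n ℕ.≤ c
injection⇒≤cardinality {A} f f-inj Pf (as , _ , as⇔P , refl) =
  injective⇒≤ {f = λ i → index (member i)}
    λ {i} {j} eq → f-inj (index-injective (setoid A) (member i) (member j) eq)
  where
  member : ∀ i → f i ∈ as
  member i = Equivalence.from (as⇔P (f i)) (Pf i)

¬¬-closePairs-cardinality : ∀ x s N .{{_ : ℕ.NonZero N}} → ¬ ¬ ∃ (HasCardinality (ClosePair x s N))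
¬¬-closePairs-cardinality x s N = ¬¬-hasCardinality (≡-dec ℕ._≟_ ℕ._≟_) (ClosePair x s N)
  (Unique.cartesianProduct⁺ (Unique.upTo⁺ (suc N)) (Unique.upTo⁺ (suc N)))
  λ ((_ , l≤N) , (_ , m≤N) , _) → ∈-cartesianProduct⁺ (∈-upTo⁺ (s≤s l≤N)) (∈-upTo⁺ (s≤s m≤N))

a*d≤c*b⇒a/b≤c/d : ∀ a b c d .{{_ : ℕ.NonZero b}} .{{_ : ℕ.NonZero d}} →
                  a ℕ.* d ℕ.≤ c ℕ.* b → + a / b ≤ + c / d
a*d≤c*b⇒a/b≤c/d a b@(suc b-1) c d@(suc d-1) ad≤cb = toℚᵘ-cancel-≤
  (ℚᵘ.≤-respˡ-≃ (ℚᵘ.≃-sym (toℚᵘ-fromℚᵘ (ℚᵘ.mkℚᵘ (+ a) b-1)))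
  (ℚᵘ.≤-respʳ-≃ (ℚᵘ.≃-sym (toℚᵘ-fromℚᵘ (ℚᵘ.mkℚᵘ (+ c) d-1)))
    (ℚᵘ.*≤* (subst₂ ℤ._≤_ (ℤ.pos-* a d) (ℤ.pos-* c b) (ℤ.+≤+ ad≤cb)))))

-- Powers of 2 modulo powers of 3

-- This is Euler's totient of `3 ^ suc m`.
period : ℕ → ℕ
period m = 2 ℕ.* 3 ^ m

-- Induction by cubing: with `a = 3 ^ suc m`, every term of `(1 + a t)³` after the first is
-- divisible by `3 a`, the last one because `a = 3 b`. The witness collects the three quotients.
2^period≡1 : ∀ m → ∃ λ t → 2 ^ period m ≡ 1 ℕ.+ 3 ^ suc m ℕ.* t
2^period≡1 zero    = 1 , refl
2^period≡1 (suc m) = let (t , eq) = 2^period≡1 m; b = 3 ^ m; a = 3 ℕ.* b in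
  t ℕ.+ a ℕ.* (t ℕ.* t) ℕ.+ b ℕ.* a ℕ.* (t ℕ.* t ℕ.* t) , (begin
    2 ^ period (suc m)
      ≡⟨ cong (2 ^_) (ℕ-solve 1 (λ b → ℕcon 2 ⊗ (ℕcon 3 ⊗ b) ⊜ ℕcon 2 ⊗ b ⊗ ℕcon 3) refl b) ⟩
    2 ^ (period m ℕ.* 3)
      ≡⟨ sym (ℕ.^-*-assoc 2 (period m) 3) ⟩
    (2 ^ period m) ^ 3
      ≡⟨ cong (_^ 3) eq ⟩
    (1 ℕ.+ a ℕ.* t) ^ 3
      ≡⟨ ℕ-solve 2 (λ b t → let a = ℕcon 3 ⊗ b; u = ℕcon 1 ⊕ a ⊗ t in
           u ⊗ (u ⊗ (u ⊗ ℕcon 1)) ⊜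
           ℕcon 1 ⊕ ℕcon 3 ⊗ a ⊗ (t ⊕ a ⊗ (t ⊗ t) ⊕ b ⊗ a ⊗ (t ⊗ t ⊗ t))) refl b t ⟩
    1 ℕ.+ 3 ^ suc (suc m) ℕ.* (t ℕ.+ a ℕ.* (t ℕ.* t) ℕ.+ b ℕ.* a ℕ.* (t ℕ.* t ℕ.* t)) ∎)
  where open ≡-Reasoning

-- The hypothesis on `l` lets `2 ^ l` supply the power of 2 in `D (suc m)`; the power of 3 divides
-- `2 ^ period m - 1`.
2^-periodic-mod-D : ∀ m l → 3 ^ suc m ℕ.≤ l →
                    ∃ λ t → 2 ^ (l ℕ.+ period m) ≡ 2 ^ l ℕ.+ t ℕ.* D (suc m)
2^-periodic-mod-D m l a≤l = let (t , eq) = 2^period≡1 m; a = 3 ^ suc m; r = 2 ^ (l ℕ.∸ a) in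
  r ℕ.* t , (begin
    2 ^ (l ℕ.+ period m)
      ≡⟨ ℕ.^-distribˡ-+-* 2 l (period m) ⟩
    2 ^ l ℕ.* 2 ^ period m
      ≡⟨ cong (2 ^ l ℕ.*_) eq ⟩
    2 ^ l ℕ.* (1 ℕ.+ a ℕ.* t)
      ≡⟨ ℕ.*-distribˡ-+ (2 ^ l) 1 (a ℕ.* t) ⟩
    2 ^ l ℕ.* 1 ℕ.+ 2 ^ l ℕ.* (a ℕ.* t)
      ≡⟨ cong₂ (λ u v → u ℕ.+ v ℕ.* (a ℕ.* t)) (ℕ.*-identityʳ (2 ^ l))
           (trans (cong (2 ^_) (sym (ℕ.m∸n+n≡m a≤l))) (ℕ.^-distribˡ-+-* 2 (l ℕ.∸ a) a)) ⟩
    2 ^ l ℕ.+ r ℕ.* 2 ^ a ℕ.* (a ℕ.* t)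
      ≡⟨ cong (2 ^ l ℕ.+_) (ℕ-solve 4 (λ r e a t → r ⊗ e ⊗ (a ⊗ t) ⊜ r ⊗ t ⊗ (a ⊗ e)) refl r (2 ^ a) a t) ⟩
    2 ^ l ℕ.+ r ℕ.* t ℕ.* D (suc m) ∎)
  where open ≡-Reasoning

-- Closeness of terms one period apart

x : ℕ → [0,1⟩
x n = fractionalPart (fromℤ (+ (2 ^ n)) · α₂,₃) (floor-2^n·α₂,₃ n)

s₀ : ℚ
s₀ = + 1 / 18

scaled-tail-small : ∀ m k → 6 ℕ.+ k ℕ.≤ 3 ^ suc m →
                    fromℤ (+ (2 ^ k)) * tail m ≤ (+ 1 / (3 ^ suc m)) {{ℕ.m^n≢0 3 (suc m)}} * s₀
scaled-tail-small m k 6+k≤N = subst₂ _≤_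
  (trans (cong (_* s₀) (cong (_* t) (trans (cong fromℤ (ℤ.pos-* 36 (2 ^ k))) (fromℤ-* (+ 36) (+ (2 ^ k))))))
    (solve 2 (λ A t → con (fromℤ (+ 36)) :* A :* t :* con s₀ := A :* (con (fromℤ (+ 2)) :* t)) refl (fromℤ (+ (2 ^ k))) t))
  refl
  (*-monoʳ-≤-nonNeg s₀
    (c*a≤b⇒c/b≤1/a (36 ℕ.* 2 ^ k) N (D (suc m)) {{ℕ.m^n≢0 3 (suc m)}} {{D≢0 (suc m)}} bound))
  where
  t = term (suc m)
  N = 3 ^ suc m

  -- The factor 36 is the 2 in `tail` times the 18 from `s₀`. The 6 in the hypothesis absorbs it, as
  -- `36 ≤ 2 ^ 6`.
  bound : 36 ℕ.* 2 ^ k ℕ.* N ℕ.≤ D (suc m)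
  bound = ℕ.≤-trans
    (ℕ.*-monoˡ-≤ N (ℕ.≤-trans (ℕ.*-monoˡ-≤ (2 ^ k) (from-yes (36 ℕ.≤? 2 ^ 6)))
      (subst (ℕ._≤ 2 ^ N) (ℕ.^-distribˡ-+-* 2 6 k) (ℕ.^-monoʳ-≤ 2 6+k≤N))))
    (ℕ.≤-reflexive (ℕ.*-comm (2 ^ N) N))

-- Cutting the series after index `suc m` leaves an integer, because `D (suc m)` divides
-- `2 ^ (l + period m) - 2 ^ l`. What remains is at most `2 ^ (l + period m)` times the tail of the
-- series.
close : ∀ m l → 3 ^ suc m ℕ.≤ l → 6 ℕ.+ (l ℕ.+ period m) ℕ.≤ 3 ^ suc (suc m) →
        ‖ value (x (l ℕ.+ period m)) -ℝ value (x l) ‖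
          ≤ℝ (+ 1 / (3 ^ suc (suc m))) {{ℕ.m^n≢0 3 (suc (suc m))}} · fromℚ s₀
close m l a≤l 6+l+p≤N {ε} 0<ε = suc m , λ {n} m<n →
    ≤-trans (distℤ-least (difference n) k) (≤-trans (bound n m<n)
      (subst (_≤ σ + ε) (+-identityʳ σ) (+-monoʳ-≤ σ (<⇒≤ 0<ε))))
  where
  N = 3 ^ suc (suc m)
  l′ = l ℕ.+ period m
  σ = (+ 1 / N) {{ℕ.m^n≢0 3 (suc (suc m))}} * s₀
  A = fromℤ (+ (2 ^ l′))
  B = fromℤ (+ (2 ^ l))
  f = Floor.⌊x⌋ (floor-2^n·α₂,₃ l′)
  g = Floor.⌊x⌋ (floor-2^n·α₂,₃ l)
  t = proj₁ (2^-periodic-mod-D m l a≤l)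
  z = proj₁ (D*S-integral (suc m))
  -- An integer close to the difference: `t z` equals `(A - B) * S (suc m)`, and `g - f` accounts
  -- for the floors removed by the fractional parts.
  k = + t ℤ.* z ℤ.+ g ℤ.- f

  difference : ℕ → ℚ
  difference n = A * S n - fromℤ f - (B * S n - fromℤ g)

  A≡B+tD : A ≡ B + fromℤ (+ t) * fromℤ (+ D (suc m))
  A≡B+tD = trans (cong (fromℤ ∘ +_) (proj₂ (2^-periodic-mod-D m l a≤l)))
    (trans (cong fromℤ (ℤ.pos-+ (2 ^ l) (t ℕ.* D (suc m))))
    (trans (fromℤ-+ (+ (2 ^ l)) (+ (t ℕ.* D (suc m))))
      (cong (_+_ B) (trans (cong fromℤ (ℤ.pos-* t (D (suc m)))) (fromℤ-* (+ t) (+ D (suc m)))))))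

  fromℤ-k : fromℤ k ≡ (A - B) * S (suc m) + fromℤ g - fromℤ f
  fromℤ-k = begin
    fromℤ k
      ≡⟨ solve 2 (λ k f → k := k :+ f :- f) refl (fromℤ k) (fromℤ f) ⟩
    fromℤ k + fromℤ f - fromℤ f
      ≡⟨ cong (_- fromℤ f) (sym (fromℤ-+ k f)) ⟩
    fromℤ (k ℤ.+ f) - fromℤ f
      ≡⟨ cong (λ i → fromℤ i - fromℤ f) (trans (ℤ.+-assoc (+ t ℤ.* z ℤ.+ g) (ℤ.- f) f)
           (trans (cong (λ i → + t ℤ.* z ℤ.+ g ℤ.+ i) (ℤ.+-inverseˡ f)) (ℤ.+-identityʳ (+ t ℤ.* z ℤ.+ g)))) ⟩
    fromℤ (+ t ℤ.* z ℤ.+ g) - fromℤ f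
      ≡⟨ cong (_- fromℤ f) (trans (fromℤ-+ (+ t ℤ.* z) g) (cong (_+ fromℤ g) (fromℤ-* (+ t) z))) ⟩
    fromℤ (+ t) * fromℤ z + fromℤ g - fromℤ f
      ≡⟨ cong (λ y → fromℤ (+ t) * y + fromℤ g - fromℤ f) (proj₂ (D*S-integral (suc m))) ⟩
    fromℤ (+ t) * (fromℤ (+ D (suc m)) * S (suc m)) + fromℤ g - fromℤ f
      ≡⟨ cong (λ y → y + fromℤ g - fromℤ f)
           (solve 4 (λ t d s b → t :* (d :* s) := (b :+ t :* d :- b) :* s) refl
             (fromℤ (+ t)) (fromℤ (+ D (suc m))) (S (suc m)) B) ⟩
    (B + fromℤ (+ t) * fromℤ (+ D (suc m)) - B) * S (suc m) + fromℤ g - fromℤ f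
      ≡⟨ cong (λ a → (a - B) * S (suc m) + fromℤ g - fromℤ f) (sym A≡B+tD) ⟩
    (A - B) * S (suc m) + fromℤ g - fromℤ f ∎
    where open ≡-Reasoning

  bound : ∀ n → suc m ℕ.≤ n → ∣ difference n - fromℤ k ∣ ≤ σ
  bound n m<n = begin
    ∣ difference n - fromℤ k ∣
      ≡⟨ cong ∣_∣ (trans (cong (λ y → difference n - y) fromℤ-k)
           (solve 6 (λ a b s u f g → (a :* s :- f :- (b :* s :- g)) :- ((a :- b) :* u :+ g :- f) := (a :- b) :* (s :- u))
             refl A B (S n) (S (suc m)) (fromℤ f) (fromℤ g))) ⟩
    ∣ (A - B) * (S n - S (suc m)) ∣
      ≡⟨ 0≤p⇒∣p∣≡p (subst (_≤ (A - B) * (S n - S (suc m))) (*-zeroʳ (A - B))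
           (*-monoˡ-≤-nonNeg (A - B) {{nonNegative 0≤A-B}} (p≤q⇒0≤q-p (S-mono m<n)))) ⟩
    (A - B) * (S n - S (suc m))
      ≤⟨ *-monoˡ-≤-nonNeg (A - B) {{nonNegative 0≤A-B}} (≤-via (S-tail m<n)
           (solve 3 (λ s u t → t :- (s :- u) := u :+ t :- s) refl (S n) (S (suc m)) (tail (suc m)))) ⟩
    (A - B) * tail (suc m)
      ≤⟨ *-monoʳ-≤-nonNeg (tail (suc m)) {{nonNegative (0≤tail (suc m))}}
           (≤-via {p = A - B} {q = A} (fromℤ-mono-≤ {+ 0} {+ (2 ^ l)} (ℤ.+≤+ z≤n))
             (solve 2 (λ a b → a :- (a :- b) := b :- con 0ℚ) refl A B)) ⟩
    A * tail (suc m)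
      ≤⟨ scaled-tail-small (suc m) l′ 6+l+p≤N ⟩
    σ ∎
    where
    open ≤-Reasoning
    0≤A-B : 0ℚ ≤ A - B
    0≤A-B = p≤q⇒0≤q-p (fromℤ-mono-≤ (ℤ.+≤+ (ℕ.^-monoʳ-≤ 2 (ℕ.m≤m+n l (period m)))))

-- Counting close pairs and the contradiction

period≤closePairs : ∀ m → 1 ℕ.≤ m → ∀ {c} →
  HasCardinality (ClosePair x (fromℚ s₀) (3 ^ suc (suc m)) {{ℕ.m^n≢0 3 (suc (suc m))}}) c → period m ℕ.≤ c
period≤closePairs m 1≤m = injection⇒≤cardinality pair
  (λ {i} {j} eq → toℕ-injective (ℕ.+-cancelˡ-≡ (3 ^ suc m) (toℕ i) (toℕ j) (cong proj₂ eq)))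
  λ i → (1≤l+p i , l+p≤N i) , (1≤l i , ℕ.≤-trans (ℕ.m≤m+n (l i) (period m)) (l+p≤N i)) ,
        (λ eq → ℕ.<-irrefl (sym eq) (ℕ.m<m+n (l i) 0<period)) ,
        close m (l i) (ℕ.m≤m+n (3 ^ suc m) (toℕ i)) (6+l+p≤N i)
  where
  l : Fin (period m) → ℕ
  l i = 3 ^ suc m ℕ.+ toℕ i

  pair : Fin (period m) → ℕ × ℕ
  pair i = l i ℕ.+ period m , l i

  0<period : 0 ℕ.< period m
  0<period = ℕ.*-mono-≤ (s≤s (z≤n {1})) (ℕ.m^n>0 3 m)

  1≤l : ∀ i → 1 ℕ.≤ l i
  1≤l i = ℕ.≤-trans (ℕ.m^n>0 3 (suc m)) (ℕ.m≤m+n (3 ^ suc m) (toℕ i))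

  1≤l+p : ∀ i → 1 ℕ.≤ l i ℕ.+ period m
  1≤l+p i = ℕ.≤-trans (1≤l i) (ℕ.m≤m+n (l i) (period m))

  6+l+p≤N : ∀ i → 6 ℕ.+ (l i ℕ.+ period m) ℕ.≤ 3 ^ suc (suc m)
  -- With `q = 3 ^ m`, the bound `9 q` splits into `7 q`, which covers `l i + period m`, and a spare
  -- `2 q`, which is at least 6 because `1 ≤ m`.
  6+l+p≤N i = subst (6 ℕ.+ (l i ℕ.+ period m) ℕ.≤_)
    (ℕ-solve 1 (λ q → ℕcon 2 ⊗ q ⊕ (ℕcon 3 ⊗ q ⊕ ℕcon 2 ⊗ q ⊕ ℕcon 2 ⊗ q) ⊜ ℕcon 3 ⊗ (ℕcon 3 ⊗ q)) refl (3 ^ m))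
    (ℕ.+-mono-≤ (ℕ.*-monoʳ-≤ 2 (ℕ.^-monoʳ-≤ 3 1≤m))
      (ℕ.+-monoˡ-≤ (period m) (ℕ.+-monoʳ-≤ (3 ^ suc m) (ℕ.<⇒≤ (toℕ<n i)))))

  l+p≤N : ∀ i → l i ℕ.+ period m ℕ.≤ 3 ^ suc (suc m)
  l+p≤N i = ℕ.≤-trans (ℕ.m≤n+m _ 6) (6+l+p≤N i)

theorem3 : ¬ PoissonianPairCorrelations (λ n → fractionalPart (fromℤ (+ (2 ^ n)) · α₂,₃) (floor-2^n·α₂,₃ n))
-- The goal is a negation, so a cardinality known only up to double negation can be used.
theorem3 poissonian = ¬¬-closePairs-cardinality x (fromℚ s₀) N λ (c , hc) →
  let (M , close-to-2s) = converges N N₀≤N c hc (positive⁻¹ δ)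
  -- Both sides of the limit estimate are constant sequences, so evaluating at the single index `M`
  -- gives an inequality of rationals.
  in contradict c (period≤closePairs m (s≤s z≤n) hc) (close-to-2s (ℕ.≤-refl {M}))
  where
  δ : ℚ
  -- The tolerance is spent twice, in the limit and in the order on the reals. The total `1/18`
  -- stays below the discrepancy `2/9 - 1/9`.
  δ = + 1 / 36

  limit = poissonian (fromℚ s₀)
    (λ {ε} 0<ε → 0 , λ _ → <⇒≤ (+-mono-< (positive⁻¹ s₀) 0<ε)) (positive⁻¹ δ)
  N₀ = proj₁ limit
  converges = proj₂ limit
  -- The successor ensures `1 ≤ m`, while `N₀` itself makes `N` large enough for the limit.
  m = suc N₀
  N = 3 ^ suc (suc m)

  instance
    N≢0 : ℕ.NonZero N
    N≢0 = ℕ.m^n≢0 3 (suc (suc m))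

  N₀≤N : N₀ ℕ.≤ N
  N₀≤N = ℕ.≤-trans (ℕ.m≤n+m N₀ 3) (ℕ.<⇒≤ (n<3^n (3 ℕ.+ N₀)))

  contradict : ∀ c → period m ℕ.≤ c → ∣ + c / N - fromℤ (+ 2) * s₀ ∣ ≤ δ + δ → ⊥
  contradict c p≤c F≤ = <-irrefl refl (<-≤-trans (from-yes (δ + δ <? + 2 / 9 - fromℤ (+ 2) * s₀))
    (≤-trans (+-monoˡ-≤ (- (fromℤ (+ 2) * s₀)) 2/9≤c/N) (≤-trans (p≤∣p∣ (+ c / N - fromℤ (+ 2) * s₀)) F≤)))
    where
    2/9≤c/N : + 2 / 9 ≤ + c / N
    2/9≤c/N = a*d≤c*b⇒a/b≤c/d 2 9 c N (subst (ℕ._≤ c ℕ.* 9)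
      (ℕ-solve 1 (λ q → ℕcon 2 ⊗ q ⊗ ℕcon 9 ⊜ ℕcon 2 ⊗ (ℕcon 3 ⊗ (ℕcon 3 ⊗ q))) refl (3 ^ m))
      (ℕ.*-monoˡ-≤ 9 p≤c))
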